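{- Let $P$ be a lattice and let $\to$ be a total binary operation on $P$. Then $\to$ is an $F$-natural esp-complementation on $P$ if and only if, for all $x,y,z\in P$, (1) $(x\to y)\wedge(x\vee y)=y$; (2) $z\le x\to(z\wedge(x\vee y))$.
   Context: For a poset $P$ and $p\in P$, $[p)=\{x: x\ge p\}$, $(p]=\{x: x\le p\}$, and for $X\subseteq P$, $L(X)$ is the set of all lower bounds of $X$ in $P$. For $x,y\in P$ let $F(x,y)=L([x)\cap[y))$. A total binary operation $\to$ on $P$ is an $F$-natural esp-complementation if, for all $x,y\in P$, the set $\{u\in P: (u]\cap F(x,y)\cap[y)=\{y\}\}$ has a greatest element and $x\to y$ is equal to it. -}

module Defs where

open import Algebra.Core using (Op₂)
open import Data.Product.Base using (_×_; ∃-syntax)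
open import Level using (Level; _⊔_)
open import Relation.Binary.Bundles using (Poset)
open import Relation.Unary using (Pred; _∈_; _∩_; _≐_)

module _ {c ℓ₁ ℓ₂ : Level} (P : Poset c ℓ₁ ℓ₂) where
  open Poset P

  PrincipalFilter : Carrier → Pred Carrier ℓ₂
  PrincipalFilter p x = p ≤ x

  PrincipalIdeal : Carrier → Pred Carrier ℓ₂
  PrincipalIdeal p x = x ≤ p

  -- Equality of elements of P is the order's own equality _≈_, so the
  -- singleton is taken up to _≈_ (unlike Relation.Unary.｛_｝, which uses _≡_).
  Singleton : Carrier → Pred Carrier ℓ₁
  Singleton p x = x ≈ p

  LowerBounds : {ℓ : Level} → Pred Carrier ℓ → Pred Carrier (c ⊔ ℓ₂ ⊔ ℓ)
  LowerBounds X l = ∀ x → x ∈ X → l ≤ x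

  IsGreatest : {ℓ : Level} → Pred Carrier ℓ → Carrier → Set (c ⊔ ℓ₂ ⊔ ℓ)
  IsGreatest X g = g ∈ X × (∀ x → x ∈ X → x ≤ g)

  F : Carrier → Carrier → Pred Carrier (c ⊔ ℓ₂)
  F x y = LowerBounds (PrincipalFilter x ∩ PrincipalFilter y)

  FComplements : Carrier → Carrier → Pred Carrier (c ⊔ ℓ₁ ⊔ ℓ₂)
  FComplements x y u =
    (PrincipalIdeal u ∩ F x y ∩ PrincipalFilter y) ≐ Singleton y

  IsFNaturalEspComplementation : Op₂ Carrier → Set (c ⊔ ℓ₁ ⊔ ℓ₂)
  IsFNaturalEspComplementation _⇒_ =
    ∀ x y → ∃[ g ] (IsGreatest (FComplements x y) g × (x ⇒ y) ≈ g)

{-# OPTIONS --safe #-}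

-- Since F(x,y) = (x ∨ y], an element u satisfies (u] ∩ F(x,y) ∩ [y) = {y} exactly
-- when u ∧ (x ∨ y) ≈ y.  So (1) says that x ⇒ y is such an element; (2) gives its
-- maximality on taking z = u, and conversely follows from maximality because z
-- itself is such an element for the pair x, z ∧ (x ∨ y).
module Submission where

open import Defs
open import Level using (Level)
open import Algebra.Core using (Op₂)
open import Algebra.Definitions using (Congruent₂)
open import Data.Product.Base using (_×_; _,_; proj₁; proj₂)
open import Function.Bundles using (_⇔_; mk⇔)
open import Relation.Binary.Lattice.Bundles using (Lattice)
import Relation.Binary.Lattice.Properties.MeetSemilattice as MeetProperties

module _ {c ℓ₁ ℓ₂ : Level} (P : Lattice c ℓ₁ ℓ₂) where
  open Lattice P
  open MeetProperties meetSemilattice using (∧-monotonic)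

  -- The meet `u ∧ (x ∨ y)` itself lies in the intersection, hence equals its only element. It is
  -- above `y` because `y` lies there too, which gives `y ≤ u`.
  FComplements⇒∧≈ : ∀ {x y u} → FComplements poset x y u → u ∧ (x ∨ y) ≈ y
  FComplements⇒∧≈ {x} {y} {u} (⊆y , y⊆) =
    ⊆y (x∧y≤x u (x ∨ y)
       , (λ w (x≤w , y≤w) → trans (x∧y≤y u (x ∨ y)) (∨-least x≤w y≤w))
       , ∧-greatest (proj₁ (y⊆ Eq.refl)) (y≤x∨y x y))

  ∧≈⇒FComplements : ∀ {x y u} → u ∧ (x ∨ y) ≈ y → FComplements poset x y u
  ∧≈⇒FComplements {x} {y} {u} u∧[x∨y]≈y =
      (λ (w≤u , w∈F , y≤w) →
        -- `x ∨ y` is one of the common upper bounds, so `w∈F` can be applied to it.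
        antisym (trans (∧-greatest w≤u (w∈F (x ∨ y) (x≤x∨y x y , y≤x∨y x y)))
                       (reflexive u∧[x∨y]≈y))
                y≤w)
    , (λ w≈y →
          trans (reflexive w≈y) (trans (reflexive (Eq.sym u∧[x∨y]≈y)) (x∧y≤x u (x ∨ y)))
        , (λ v (_ , y≤v) → trans (reflexive w≈y) y≤v)
        , reflexive (Eq.sym w≈y))

  -- No distributivity is involved: the inner join stays below `x ∨ y` but still lies above
  -- `z ∧ (x ∨ y)`.
  ∧-∨-∧-collapse : ∀ x y z → z ∧ (x ∨ (z ∧ (x ∨ y))) ≈ z ∧ (x ∨ y)
  ∧-∨-∧-collapse x y z = antisym
    (∧-monotonic refl (∨-least (x≤x∨y x y) (x∧y≤y z (x ∨ y))))
    (∧-greatest (x∧y≤x z (x ∨ y)) (y≤x∨y x (z ∧ (x ∨ y))))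

theorem7p10 : {c ℓ₁ ℓ₂ : Level} (P : Lattice c ℓ₁ ℓ₂) →
    let open Lattice P in
    (_⇒_ : Op₂ Carrier) → Congruent₂ _≈_ _⇒_ →
    IsFNaturalEspComplementation poset _⇒_ ⇔
    (∀ x y z → ((x ⇒ y) ∧ (x ∨ y) ≈ y) × (z ≤ (x ⇒ (z ∧ (x ∨ y)))))
theorem7p10 P _⇒_ ⇒-cong = mk⇔ esp⇒laws laws⇒esp
  where
  open Lattice P
  open MeetProperties meetSemilattice using (∧-cong)

  Laws : Set _
  Laws = ∀ x y z → ((x ⇒ y) ∧ (x ∨ y) ≈ y) × (z ≤ (x ⇒ (z ∧ (x ∨ y))))

  esp⇒laws : IsFNaturalEspComplementation poset _⇒_ → Laws
  esp⇒laws esp x y z =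
    let _ , (g∈ , _) , x⇒y≈g = esp x y
        _ , (_ , greatest) , x⇒t≈h = esp x (z ∧ (x ∨ y))
    in Eq.trans (∧-cong x⇒y≈g Eq.refl) (FComplements⇒∧≈ P g∈)
     , trans (greatest z (∧≈⇒FComplements P (∧-∨-∧-collapse P x y z)))
             (reflexive (Eq.sym x⇒t≈h))

  laws⇒esp : Laws → IsFNaturalEspComplementation poset _⇒_
  laws⇒esp laws x y =
      (x ⇒ y)
    , ( ∧≈⇒FComplements P (proj₁ (laws x y y))
      -- Law (2) at `z = u` bounds `u` by `x ⇒ (u ∧ (x ∨ y))`, whose right argument is `y` only up
      -- to `_≈_`; hence the appeal to congruence.
      , (λ u u∈ → trans (proj₂ (laws x y u))
                        (reflexive (⇒-cong Eq.refl (FComplements⇒∧≈ P u∈)))))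
    , Eq.refl
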